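{- There is a sequence of finite simple graphs with neighborhood diversity $\nu\to\infty$ such that a graph in the sequence with $n$ vertices and neighborhood diversity $\nu$ has at least $(n/\nu+1-o(1))^{\nu(1-o(1))}$ pairwise non-isomorphic positions of Arc Kayles, where the $o(1)$ terms tend to $0$ as $\nu\to\infty$.
   Context: Arc Kayles is played by two players on a finite undirected graph $G$. The players move alternately; on a turn a player must choose an edge $\{u,v\}$ of the current graph, after which the play continues on the graph obtained by deleting the vertices $u$ and $v$. A player who has no edge to choose on their turn loses. A position of Arc Kayles on $G$ is an induced subgraph of $G$ that can arise during a play, i.e. a graph $G[V\setminus\bigcup M]$ for a matching $M$ of $G$, where $\bigcup M$ is the set of endpoints of edges in $M$. Two vertices $u,v$ are twins if $N(u)\setminus\{v\}=N(v)\setminus\{u\}$. The neighborhood diversity of $G=(V,E)$ is the minimum number $w$ such that $V$ can be partitioned into $w$ sets such that any two vertices in the same set are twins. -}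

module Defs where

open import Data.Fin.Base using (Fin)
open import Data.Integer.Base using (+_)
open import Data.List.Base using (List; []; _∷_; concatMap)
open import Data.List.Membership.Propositional using (_∉_)
open import Data.List.Relation.Binary.Disjoint.Propositional using (Disjoint)
open import Data.List.Relation.Unary.All using (All)
open import Data.List.Relation.Unary.AllPairs using (AllPairs)
open import Data.Nat.Base as ℕ using (ℕ; suc)
open import Data.Product.Base using (Σ-syntax; ∃; ∃-syntax; _×_; _,_; proj₁; uncurry)
open import Data.Rational.Base as ℚ using (ℚ; 0ℚ; _/_)
open import Algebra.Definitions.RawSemiring ℚ.+-*-rawSemiring using (_^_)
open import Function.Base using (_on_)
open import Function.Bundles using (_↔_; _⇔_; Inverse)
open import Function.Definitions using (Surjective)
open import Level using (0ℓ)
open import Relation.Binary.Core using (Rel)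
open import Relation.Binary.Definitions using (Decidable; Irreflexive; Symmetric)
open import Relation.Binary.PropositionalEquality.Core using (_≡_; _≢_)
open import Relation.Nullary.Negation.Core using (¬_)
open import Relation.Unary using (Pred; _≐_; _∖_; ｛_｝)

record SimpleGraph (V : Set) : Set₁ where
  field
    Adj         : Rel V 0ℓ
    adj?        : Decidable Adj
    symmetric   : Symmetric Adj
    irreflexive : Irreflexive _≡_ Adj

open SimpleGraph

infix 4 _≅_

_≅_ : {V W : Set} → SimpleGraph V → SimpleGraph W → Set
_≅_ {V} {W} G H =
  Σ[ f ∈ V ↔ W ] (∀ u v → Adj G u v ⇔ Adj H (Inverse.to f u) (Inverse.to f v))

induced : {V : Set} → SimpleGraph V → (P : Pred V 0ℓ) → SimpleGraph (∃ P)
induced G P = record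
  { Adj         = Adj G on proj₁
  ; adj?        = λ u v → adj? G (proj₁ u) (proj₁ v)
  ; symmetric   = symmetric G
  ; irreflexive = λ { _≡_.refl → irreflexive G _≡_.refl }
  }

module _ {V : Set} (G : SimpleGraph V) where

  Twins : Rel V 0ℓ
  Twins u v = (Adj G u ∖ ｛ v ｝) ≐ (Adj G v ∖ ｛ u ｝)

  -- A partition into w (nonempty) sets is a surjection onto Fin w; its fibres
  -- are the sets.
  TwinPartition : ℕ → Set
  TwinPartition w = Σ[ part ∈ (V → Fin w) ]
    Surjective _≡_ _≡_ part × (∀ u v → part u ≡ part v → Twins u v)

  IsNeighbourhoodDiversity : ℕ → Set
  IsNeighbourhoodDiversity ν =
    TwinPartition ν × (∀ w → TwinPartition w → ν ℕ.≤ w)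

endpoints : {V : Set} → V × V → List V
endpoints (u , v) = u ∷ v ∷ []

-- An edge {u,v} is given by either of the pairs (u , v) and (v , u).
record Matching {V : Set} (G : SimpleGraph V) : Set where
  field
    edges    : List (V × V)
    areEdges : All (uncurry (Adj G)) edges
    disjoint : AllPairs (Disjoint on endpoints) edges

  -- Proofs of v ∉ xs are judgementally equal, so each uncovered vertex gives
  -- exactly one element of ∃ Uncovered.
  Uncovered : Pred V 0ℓ
  Uncovered v = v ∉ concatMap endpoints edges

position : {V : Set} (G : SimpleGraph V) (M : Matching G) →
           SimpleGraph (∃ (Matching.Uncovered M))
position G M = induced G (Matching.Uncovered M)

NonIsomorphicPositions : {V : Set} → SimpleGraph V → ℕ → Set
NonIsomorphicPositions G k = Σ[ M ∈ (Fin k → Matching G) ]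
  (∀ i j → i ≢ j → ¬ (position G (M i) ≅ position G (M j)))

TendsToInfinity : (ℕ → ℕ) → Set
TendsToInfinity a = ∀ B → ∃[ N ] (∀ i → N ℕ.≤ i → B ℕ.≤ a i)

TendsToZero : (ℕ → ℚ) → Set
TendsToZero δ = ∀ ε → 0ℚ ℚ.< ε → ∃[ N ] (∀ m → N ℕ.≤ m → ℚ.∣ δ m ∣ ℚ.< ε)

-- The real inequality b ^ e ≤ k for b, e ≥ 0: with e = p / q and q > 0 it says
-- b ^ p ≤ k ^ q.  The choice of p and q is immaterial, as t ↦ t ^ m is strictly
-- increasing on t ≥ 0 for m > 0.  The relation is empty if b < 0 or e < 0.
RealPower≤ : (b e : ℚ) (k : ℕ) → Set
RealPower≤ b e k = 0ℚ ℚ.≤ b ×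
  (∃[ p ] ∃[ q-1 ] e ≡ + p / suc q-1 × b ^ p ℚ.≤ + (k ℕ.^ suc q-1) / 1)

-- For a twin-free graph the base n/ν + 1 is 2, so 2 ^ (ν (1 − o(1))) positions
-- suffice.  The graph consists of a clique ("core") with 4 + s vertices, and of
-- only O(√ s) further vertices that make every position rigid: ports, to which
-- the core vertices are joined according to an injective code, and leaves,
-- leaf j being joined to the ports i ≤ j.  Any subset of s designated core
-- vertices can be deleted by a matching inside the clique, one further core
-- vertex repairing the parity.  An isomorphism between two such positions fixes
-- leaf j and port j, by induction on j: leaf j is the only remaining vertex with
-- a single neighbour outside the ports i < j, and that neighbour is port j.
-- Hence it preserves codes and fixes the core vertices, so the deleted sets agree.
module Submission where

open import Defs
open import Data.Empty using (⊥; ⊥-elim)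
open import Data.Fin.Base
  using (Fin; zero; suc; toℕ; _<_; _≤_; finToFun; combine; quotient; remainder; inject≤; splitAt; _↑ˡ_; _↑ʳ_)
open import Data.Fin.Induction using (<-wellFounded)
import Data.Fin.Properties as Fin
open import Data.Integer.Base using (+_; +<+)
import Data.Integer.Base as ℤ
import Data.Integer.Properties as ℤ
open import Data.List.Base using (List; []; _∷_; concatMap; map; filter; allFin)
open import Data.List.Membership.Propositional using (_∈_; _∉_; lose)
open import Data.List.Membership.Propositional.Properties
  using (∈-map⁺; ∈-map⁻; ∈-filter⁺; ∈-filter⁻; ∈-allFin; ∈-concatMap⁺)
open import Data.List.Relation.Binary.Disjoint.Propositional using (Disjoint)
open import Data.List.Relation.Unary.All as All using (All; []; _∷_)
import Data.List.Relation.Unary.All.Properties as All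
open import Data.List.Relation.Unary.AllPairs as AllPairs using (AllPairs; []; _∷_)
import Data.List.Relation.Unary.AllPairs.Properties as AllPairs
open import Data.List.Relation.Unary.Any using (here; there)
open import Data.List.Relation.Unary.Unique.Propositional using (Unique)
import Data.List.Relation.Unary.Unique.Propositional.Properties as Unique
open import Data.Nat.Base as ℕ using (ℕ; zero; suc; NonZero; _⊓_; _∸_; s≤s; z≤n)
import Data.Nat.Properties as ℕ
open import Data.Nat.Tactic.RingSolver using (solve-∀)
open import Data.Product.Base using (Σ-syntax; ∃; ∃-syntax; ∃₂; _×_; _,_; proj₁; proj₂; uncurry)
open import Data.Rational.Base using (ℚ; mkℚ; 0ℚ; 1ℚ; _/_; _+_; _-_; _*_; -_; toℚᵘ; ↧ₙ_; *<*)
import Data.Rational.Base as ℚ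
open import Algebra.Definitions.RawSemiring ℚ.+-*-rawSemiring using (_^_)
import Data.Rational.Properties as ℚ
open import Data.Rational.Unnormalised.Base using (mkℚᵘ; *≡*)
import Data.Rational.Unnormalised.Base as ℚᵘ
import Data.Rational.Unnormalised.Properties as ℚᵘ
open import Data.Sum.Base using (_⊎_; inj₁; inj₂)
open import Data.Sum.Function.Propositional using (_⊎-↔_)
open import Data.Unit.Base using (⊤; tt)
open import Function.Base using (_∘_; _on_; id)
open import Function.Bundles using (_↔_; _⇔_; Injection; Inverse; Equivalence; mk⇔)
open import Function.Construct.Composition using (_↔-∘_)
open import Function.Properties.Inverse using (↔-refl; ↔⇒↣)
open import Induction.WellFounded using (module All)
open import Level using (0ℓ)
open import Relation.Binary.Core using (REL)
open import Relation.Binary.Definitions using (Decidable; Symmetric; tri<; tri≈; tri>)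
open import Relation.Binary.PropositionalEquality
  using (_≡_; _≢_; refl; sym; trans; cong; cong₂; subst; subst₂; module ≡-Reasoning)
open import Relation.Nullary using (¬_; yes; no; contradiction)
open import Relation.Nullary.Decidable using (decidable-stable; ¬?; _×-dec_)
open import Relation.Unary as Unary using (Pred)

-- Numbering of finite functions, and pairing up a list.

finToFun-injective : ∀ {m} n (i j : Fin (m ℕ.^ n)) →
  (∀ v → finToFun {m} {n} i v ≡ finToFun j v) → i ≡ j
finToFun-injective zero    zero zero _   = refl
finToFun-injective {m} (suc n) i j i≗j = begin
  i
    ≡⟨ Fin.combine-remQuot {m} (m ℕ.^ n) i ⟨
  combine (quotient {m} (m ℕ.^ n) i) (remainder {m} (m ℕ.^ n) i)
    ≡⟨ cong₂ combine (i≗j zero) (finToFun-injective n _ _ (i≗j ∘ suc)) ⟩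
  combine (quotient {m} (m ℕ.^ n) j) (remainder {m} (m ℕ.^ n) j)
    ≡⟨ Fin.combine-remQuot {m} (m ℕ.^ n) j ⟩
  j ∎
  where open ≡-Reasoning

module _ {A : Set} (q : A) where

  pairUp : List A → List (A × A)
  pairUp []           = []
  pairUp (x ∷ [])     = (x , q) ∷ []
  pairUp (x ∷ y ∷ xs) = (x , y) ∷ pairUp xs

  ∈-pairUp⁺ : ∀ {v} xs → v ∈ xs → v ∈ concatMap endpoints (pairUp xs)
  ∈-pairUp⁺ (x ∷ [])     (here refl)         = here refl
  ∈-pairUp⁺ (x ∷ y ∷ xs) (here refl)         = here refl
  ∈-pairUp⁺ (x ∷ y ∷ xs) (there (here refl)) = there (here refl)
  ∈-pairUp⁺ (x ∷ y ∷ xs) (there (there v∈))  = there (there (∈-pairUp⁺ xs v∈))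

  ∈-pairUp⁻ : ∀ {v} xs → v ∈ concatMap endpoints (pairUp xs) → v ∈ q ∷ xs
  ∈-pairUp⁻ (x ∷ [])     (here refl)         = there (here refl)
  ∈-pairUp⁻ (x ∷ [])     (there (here refl)) = here refl
  ∈-pairUp⁻ (x ∷ y ∷ xs) (here refl)         = there (here refl)
  ∈-pairUp⁻ (x ∷ y ∷ xs) (there (here refl)) = there (there (here refl))
  ∈-pairUp⁻ (x ∷ y ∷ xs) (there (there v∈)) with ∈-pairUp⁻ xs v∈
  ... | here v≡q  = here v≡q
  ... | there v∈ₓ = there (there (there v∈ₓ))

  pairUp-related : ∀ {R : A → A → Set} → Symmetric R → ∀ xs →
    AllPairs R (q ∷ xs) → All (uncurry R) (pairUp xs)
  pairUp-related R-sym []           _ = []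
  pairUp-related R-sym (x ∷ [])     ((qRx ∷ []) ∷ _) = R-sym qRx ∷ []
  pairUp-related R-sym (x ∷ y ∷ xs) ((_ ∷ _ ∷ q~) ∷ (xRy ∷ _) ∷ _ ∷ xs~) =
    xRy ∷ pairUp-related R-sym xs (q~ ∷ xs~)

  pairUp-disjoint : ∀ xs → Unique (q ∷ xs) →
    AllPairs (Disjoint on endpoints) (pairUp xs)
  pairUp-disjoint []           _ = []
  pairUp-disjoint (x ∷ [])     _ = [] ∷ []
  pairUp-disjoint (x ∷ y ∷ xs) ((q≢x ∷ q≢y ∷ q≢) ∷ (x≢y ∷ x≢) ∷ y≢ ∷ xs!) =
    All.tabulate disjoint ∷ pairUp-disjoint xs (q≢ ∷ xs!)
    where
    fresh : ∀ {v} → v ∈ x ∷ y ∷ [] → v ∉ q ∷ xs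
    fresh (here refl)         (here refl) = q≢x refl
    fresh (here refl)         (there v∈)  = All.lookup x≢ v∈ refl
    fresh (there (here refl)) (here refl) = q≢y refl
    fresh (there (here refl)) (there v∈)  = All.lookup y≢ v∈ refl
    disjoint : ∀ {e} → e ∈ pairUp xs → Disjoint (x ∷ y ∷ []) (endpoints e)
    disjoint e∈ (v∈xy , v∈e) =
      fresh v∈xy (∈-pairUp⁻ xs (∈-concatMap⁺ endpoints (lose e∈ v∈e)))

-- The graph of a code: core clique, ports and leaves.

module Coded {s d : ℕ} (Code : REL (Fin (4 ℕ.+ s)) (Fin d) 0ℓ) (code? : Decidable Code)
  -- Core `zero` is joined to every port. This gives each port a permanent neighbour in the core,
  -- which no leaf has.
  (code-zero : ∀ i → Code zero i)
  (code-injective : ∀ u v → (∀ i → Code u i ⇔ Code v i) → u ≡ v) where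

  Vertex : Set
  Vertex = Fin (4 ℕ.+ s) ⊎ (Fin d ⊎ Fin d)

  pattern core v = inj₁ v
  pattern port i = inj₂ (inj₁ i)
  pattern leaf j = inj₂ (inj₂ j)

  -- Ports and leaves span a half graph, in which the vertices of one side have pairwise different
  -- degrees.
  Adj : Vertex → Vertex → Set
  Adj (core u) (core v) = u ≢ v
  Adj (core u) (port i) = Code u i
  Adj (core u) (leaf j) = ⊥
  Adj (port i) (core u) = Code u i
  Adj (port i) (port j) = ⊥
  Adj (port i) (leaf j) = i ≤ j
  Adj (leaf j) (core u) = ⊥
  Adj (leaf j) (port i) = i ≤ j
  Adj (leaf i) (leaf j) = ⊥

  adj? : Decidable Adj
  adj? (core u) (core v) = ¬? (u Fin.≟ v)
  adj? (core u) (port i) = code? u i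
  adj? (core u) (leaf j) = no λ ()
  adj? (port i) (core u) = code? u i
  adj? (port i) (port j) = no λ ()
  adj? (port i) (leaf j) = i Fin.≤? j
  adj? (leaf j) (core u) = no λ ()
  adj? (leaf j) (port i) = i Fin.≤? j
  adj? (leaf i) (leaf j) = no λ ()

  adj-sym : ∀ x y → Adj x y → Adj y x
  adj-sym (core u) (core v) u≢v = u≢v ∘ sym
  adj-sym (core u) (port i) c = c
  adj-sym (port i) (core u) c = c
  adj-sym (port i) (leaf j) c = c
  adj-sym (leaf j) (port i) c = c

  adj-irrefl : ∀ x → ¬ Adj x x
  adj-irrefl (core u) u≢u = u≢u refl
  adj-irrefl (port i) ()
  adj-irrefl (leaf j) ()

  -- No matching below covers these vertices, so they occur in every position.
  Permanent : Vertex → Set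
  Permanent (core v)  = toℕ v ℕ.< 3
  Permanent (inj₂ _)  = ⊤

  -- Three permanent core vertices ensure this: any core vertex keeps two permanent neighbours in
  -- the core, so it cannot pose as a leaf.
  two-others : (v : Fin (4 ℕ.+ s)) → ∃₂ λ x y →
    x ≢ y × (v ≢ x × toℕ x ℕ.< 3) × (v ≢ y × toℕ y ℕ.< 3)
  two-others zero          = suc zero , suc (suc zero) ,
    (λ ()) , ((λ ()) , s≤s (s≤s z≤n)) , ((λ ()) , s≤s (s≤s (s≤s z≤n)))
  two-others (suc zero)    = zero , suc (suc zero) ,
    (λ ()) , ((λ ()) , s≤s z≤n) , ((λ ()) , s≤s (s≤s (s≤s z≤n)))
  two-others (suc (suc v)) = zero , suc zero ,
    (λ ()) , ((λ ()) , s≤s z≤n) , ((λ ()) , s≤s (s≤s z≤n))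

  adj-leaf : ∀ {x j} → Adj x (leaf j) → ∃[ i ] x ≡ port i × i ≤ j
  adj-leaf {port i} i≤j = i , refl , i≤j

  -- Rigidity of the positions.

  record Labelling (A : Set) : Set where
    field
      label     : A → Vertex
      injective : ∀ {p p′} → label p ≡ label p′ → p ≡ p′
      permanent : ∀ x → Permanent x → ∃[ p ] label p ≡ x

  module Rigidity {A B : Set} (P : Labelling A) (Q : Labelling B) (f : A ↔ B)
    (adj : ∀ p p′ → Adj (Labelling.label P p) (Labelling.label P p′) ⇔
      Adj (Labelling.label Q (Inverse.to f p)) (Labelling.label Q (Inverse.to f p′)))
    where

    open Labelling P using ()
      renaming (label to α; injective to α-injective; permanent to α-permanent)
    open Labelling Q using ()
      renaming (label to β; injective to β-injective; permanent to β-permanent)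
    open Inverse f using (to; from; strictlyInverseˡ)

    -- The backward implication keeps the images of other vertices off a label that is already
    -- fixed.
    Fixes : Vertex → Set
    Fixes x = ∀ p → α p ≡ x ⇔ β (to p) ≡ x

    to-injective : ∀ {p p′} → to p ≡ to p′ → p ≡ p′
    to-injective = Injection.injective (↔⇒↣ f)

    -- Labels and `to` are injective, so a single vertex labelled `x` on both sides decides the
    -- matter for all `p`.
    fixes-permanent : ∀ {x} → ∃[ p ] α p ≡ x × β (to p) ≡ x → Fixes x
    fixes-permanent {x} (p₀ , αp₀ , βp₀) p = mk⇔
      (λ αp → trans (cong (β ∘ to) (α-injective (trans αp (sym αp₀)))) βp₀)
      (λ βp → trans (cong α (to-injective (β-injective (trans βp (sym βp₀))))) αp₀)

    -- Permanence supplies a vertex labelled `x`, and its image is again labelled `x`. This is how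
    -- codes are read off in the other position.
    fixed-adj : ∀ {x} → Fixes x → Permanent x → ∀ p → Adj (α p) x ⇔ Adj (β (to p)) x
    fixed-adj {x} fx perm p with α-permanent x perm
    ... | p₀ , refl = mk⇔
      (λ e → subst (Adj (β (to p))) (Equivalence.to (fx p₀) refl) (Equivalence.to (adj p p₀) e))
      (λ e → Equivalence.from (adj p p₀)
        (subst (Adj (β (to p))) (sym (Equivalence.to (fx p₀) refl)) e))

    module Stage (j : Fin d) (ih : ∀ {i} → i < j → Fixes (port i) × Fixes (leaf i)) where

      pₗ pₐ : A
      pₗ = proj₁ (α-permanent (leaf j) tt)
      pₐ = proj₁ (α-permanent (port j) tt)

      αpₗ : α pₗ ≡ leaf j
      αpₗ = proj₂ (α-permanent (leaf j) tt)

      αpₐ : α pₐ ≡ port j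
      αpₐ = proj₂ (α-permanent (port j) tt)

      -- The preimage of `y` is a neighbour of leaf `j`, hence a port `i ≤ j`. If `i < j`, it is
      -- fixed by induction and `y` would be that earlier port; so it is port `j`.
      lonely : ∀ {y} → Permanent y → (∀ {i} → i < j → y ≢ port i) →
               Adj (β (to pₗ)) y → y ≡ β (to pₐ)
      lonely {y} perm late e with β-permanent y perm
      ... | q , refl with adj-leaf (subst (Adj (α (from q))) αpₗ
               (Equivalence.from (adj (from q) pₗ)
                 (subst (λ z → Adj (β z) (β (to pₗ))) (sym (strictlyInverseˡ q)) (adj-sym (β (to pₗ)) (β q) e))))
      ... | i , αp≡i , i≤j with Fin.<-cmp i j
      ... | tri< i<j _ _ = contradiction
        (trans (cong β (sym (strictlyInverseˡ q))) (Equivalence.to (proj₁ (ih i<j) (from q)) αp≡i))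
        (late i<j)
      ... | tri≈ _ refl _ = cong β (trans (sym (strictlyInverseˡ q))
                              (cong to (α-injective (trans αp≡i (sym αpₐ)))))
      ... | tri> _ _ j<i = contradiction i≤j (ℕ.<⇒≱ j<i)

      not-two : ∀ {x y y′} → β (to pₗ) ≡ x → y ≢ y′ → Permanent y → Permanent y′ →
        (∀ {i} → i < j → y ≢ port i) → (∀ {i} → i < j → y′ ≢ port i) →
        Adj x y → ¬ Adj x y′
      not-two refl y≢y′ py py′ ly ly′ e e′ =
        y≢y′ (trans (lonely py ly e) (sym (lonely py′ ly′ e′)))

      -- An earlier port or leaf is already the image of its namesake. Any other candidate except
      -- leaf `j` has two permanent neighbours outside the earlier ports, which `lonely` would
      -- identify.
      leaf-image : ∀ x → β (to pₗ) ≡ x → x ≡ leaf j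
      leaf-image (core v) eq with two-others v
      ... | x , y , x≢y , (v≢x , px) , (v≢y , py) =
        ⊥-elim (not-two {y = core x} {core y} eq (λ { refl → x≢y refl }) px py
          (λ _ ()) (λ _ ()) v≢x v≢y)
      leaf-image (port k) eq with k Fin.<? j
      ... | yes k<j with () ← trans (sym (Equivalence.from (proj₁ (ih k<j) pₗ) eq)) αpₗ
      ... | no _ = ⊥-elim (not-two {y = leaf k} {core zero} eq (λ ()) tt (s≤s z≤n)
          (λ _ ()) (λ _ ()) Fin.≤-refl (code-zero k))
      leaf-image (leaf k) eq with Fin.<-cmp k j
      ... | tri< k<j k≢j _
        with refl ← trans (sym (Equivalence.from (proj₂ (ih k<j) pₗ) eq)) αpₗ = contradiction refl k≢j
      ... | tri≈ _ refl _ = refl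
      ... | tri> _ _ j<k = ⊥-elim (not-two {y = port j} {port k} eq
          (λ { refl → ℕ.<-irrefl refl j<k }) tt tt
          (λ { i<j refl → ℕ.<-irrefl refl i<j }) (λ { i<j refl → ℕ.<-asym i<j j<k })
          (ℕ.<⇒≤ j<k) Fin.≤-refl)

      fixes-leaf : Fixes (leaf j)
      fixes-leaf = fixes-permanent (pₗ , αpₗ , leaf-image _ refl)

      -- The image is adjacent to the fixed leaf `j`, hence a port `i ≤ j`, and the ports below `j`
      -- are already taken.
      port-image : β (to pₐ) ≡ port j
      port-image with adj-leaf (Equivalence.to (fixed-adj fixes-leaf tt pₐ)
                       (subst (λ z → Adj z (leaf j)) (sym αpₐ) (Fin.≤-refl {x = j})))
      ... | i , eq , i≤j with Fin.<-cmp i j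
      ... | tri< i<j i≢j _
        with refl ← trans (sym (Equivalence.from (proj₁ (ih i<j) pₐ) eq)) αpₐ = contradiction refl i≢j
      ... | tri≈ _ refl _ = eq
      ... | tri> _ _ j<i = contradiction i≤j (ℕ.<⇒≱ j<i)

    fixes-port×leaf : ∀ j → Fixes (port j) × Fixes (leaf j)
    fixes-port×leaf = All.wfRec <-wellFounded 0ℓ (λ j → Fixes (port j) × Fixes (leaf j))
      λ j ih → let open Stage j ih in fixes-permanent (pₐ , αpₐ , port-image) , fixes-leaf

    -- Ports and leaves are fixed, so the image is some core `u`; adjacency to the fixed ports gives
    -- `u` and `v` the same code. This is weaker than `Fixes`, since `core v` could be missing from
    -- the first position.
    fixes-core : ∀ {v} p → α p ≡ core v → β (to p) ≡ core v
    fixes-core {v} p αp with β (to p) in eq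
    ... | port i with () ← trans (sym αp) (Equivalence.from (proj₁ (fixes-port×leaf i) p) eq)
    ... | leaf j with () ← trans (sym αp) (Equivalence.from (proj₂ (fixes-port×leaf j) p) eq)
    ... | core u = cong core (code-injective u v λ i → same i)
      where
      same : ∀ i → Code u i ⇔ Code v i
      same i with fixed-adj (proj₁ (fixes-port×leaf i)) tt p
      ... | e rewrite αp | eq = mk⇔ (Equivalence.from e) (Equivalence.to e)

    -- The preimage is neither a port nor a leaf, as these are fixed; `fixes-core` then names it.
    core-reflected : ∀ {v} q → β q ≡ core v → ∃[ p ] α p ≡ core v
    core-reflected {v} q βq = from q , helper (trans (cong β (strictlyInverseˡ q)) βq)
      where
      helper : β (to (from q)) ≡ core v → α (from q) ≡ core v
      helper βp with α (from q) in eq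
      ... | core u = sym (trans (sym βp) (fixes-core (from q) eq))
      ... | port i
        with () ← trans (sym βp) (Equivalence.to (proj₁ (fixes-port×leaf i) (from q)) eq)
      ... | leaf j
        with () ← trans (sym βp) (Equivalence.to (proj₂ (fixes-port×leaf j) (from q)) eq)

  -- Absence of twins, and neighbourhood diversity.

  twin-free : ∀ x y → (∀ z → z ≢ x → z ≢ y → Adj x z ⇔ Adj y z) → x ≡ y
  twin-free (core u) (core v) tw = cong core (code-injective u v (λ i → tw (port i) (λ ()) (λ ())))
  twin-free (core u) (port i) tw = ⊥-elim (Equivalence.from (tw (leaf i) (λ ()) (λ ())) Fin.≤-refl)
  twin-free (port i) (core u) tw = ⊥-elim (Equivalence.to (tw (leaf i) (λ ()) (λ ())) Fin.≤-refl)
  twin-free (core u) (leaf j) tw with two-others u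
  ... | x , _ , _ , (u≢x , _) , _ =
    ⊥-elim (Equivalence.to (tw (core x) (λ { refl → u≢x refl }) (λ ())) u≢x)
  twin-free (leaf j) (core u) tw with two-others u
  ... | x , _ , _ , (u≢x , _) , _ =
    ⊥-elim (Equivalence.from (tw (core x) (λ ()) (λ { refl → u≢x refl })) u≢x)
  twin-free (port i) (port j) tw = cong port (Fin.≤-antisym
    (Equivalence.from (tw (leaf j) (λ ()) (λ ())) Fin.≤-refl)
    (Equivalence.to (tw (leaf i) (λ ()) (λ ())) Fin.≤-refl))
  twin-free (leaf i) (leaf j) tw = cong leaf (Fin.≤-antisym
    (Equivalence.to (tw (port i) (λ ()) (λ ())) Fin.≤-refl)
    (Equivalence.from (tw (port j) (λ ()) (λ ())) Fin.≤-refl))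
  twin-free (port i) (leaf j) tw = ⊥-elim (Equivalence.to (tw (core zero) (λ ()) (λ ())) (code-zero i))
  twin-free (leaf j) (port i) tw = ⊥-elim (Equivalence.from (tw (core zero) (λ ()) (λ ())) (code-zero i))

  order : ℕ
  order = 4 ℕ.+ s ℕ.+ (d ℕ.+ d)

  vertices : Fin order ↔ Vertex
  vertices = (↔-refl ⊎-↔ Fin.+↔⊎) ↔-∘ Fin.+↔⊎

  open Inverse vertices using (to; from; strictlyInverseˡ)

  to-injective : ∀ {x y} → to x ≡ to y → x ≡ y
  to-injective = Injection.injective (↔⇒↣ vertices)

  graph : SimpleGraph (Fin order)
  graph = record
    { Adj         = Adj on to
    ; adj?        = λ x y → adj? (to x) (to y)
    ; symmetric   = λ {x} {y} → adj-sym (to x) (to y)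
    ; irreflexive = λ { {x} refl → adj-irrefl (to x) }
    }

  twins⇒≡ : ∀ {x y} → Twins graph x y → x ≡ y
  twins⇒≡ {x} {y} (x⊆y , y⊆x) = to-injective (twin-free (to x) (to y) λ z z≢x z≢y →
    let x≢ : x ≢ from z
        x≢ = λ eq → z≢x (trans (sym (strictlyInverseˡ z)) (cong to (sym eq)))
        y≢ : y ≢ from z
        y≢ = λ eq → z≢y (trans (sym (strictlyInverseˡ z)) (cong to (sym eq)))
        z≡ = strictlyInverseˡ z
    in mk⇔
      (λ e → subst (Adj (to y)) z≡ (proj₁ (x⊆y (subst (Adj (to x)) (sym z≡) e , y≢))))
      (λ e → subst (Adj (to x)) z≡ (proj₁ (y⊆x (subst (Adj (to y)) (sym z≡) e , x≢)))))

  -- Since twins coincide, any partition into twin classes is injective and needs `order` classes;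
  -- thus `ν = n`.
  neighbourhoodDiversity : IsNeighbourhoodDiversity graph order
  neighbourhoodDiversity =
    (id , (λ x → x , id) , λ { x _ refl → id , id }) ,
    λ w (part , _ , twins) → Fin.injective⇒≤ {f = part} (λ eq → twins⇒≡ (twins _ _ eq))

  -- Deleting a chosen set of core vertices by a matching.

  coreVertex : Fin (4 ℕ.+ s) → Fin order
  coreVertex = from ∘ core

  to-coreVertex : ∀ v → to (coreVertex v) ≡ core v
  to-coreVertex v = strictlyInverseˡ (core v)

  coreVertex-injective : ∀ {u v} → coreVertex u ≡ coreVertex v → u ≡ v
  coreVertex-injective {u} {v} eq
    with refl ← trans (sym (to-coreVertex u)) (trans (cong to eq) (to-coreVertex v)) = refl

  -- Deleted along with the chosen vertices when their number is odd.
  dump : Fin (4 ℕ.+ s)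
  dump = suc (suc (suc zero))

  optional : Fin s → Fin (4 ℕ.+ s)
  optional v = suc (suc (suc (suc v)))

  module Deletion {T : Pred (Fin s) 0ℓ} (T? : Unary.Decidable T) where

    chosen : List (Fin (4 ℕ.+ s))
    chosen = map optional (filter T? (allFin s))

    dump∷chosen-unique : Unique (dump ∷ chosen)
    dump∷chosen-unique =
      All.map⁺ (All.tabulate (λ _ ())) ∷
      Unique.map⁺ (λ { refl → refl }) (Unique.filter⁺ T? (Unique.allFin⁺ s))

    matching : Matching graph
    matching = record
      { edges    = pairUp (coreVertex dump) (map coreVertex chosen)
      ; areEdges = pairUp-related (coreVertex dump) (λ {x} {y} → adj-sym (to x) (to y))
          (map coreVertex chosen)
          (AllPairs.map⁺ {xs = dump ∷ chosen} (AllPairs.map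
            (λ {u} {v} u≢v → subst₂ Adj (sym (to-coreVertex u)) (sym (to-coreVertex v)) u≢v)
            dump∷chosen-unique))
      ; disjoint = pairUp-disjoint (coreVertex dump) (map coreVertex chosen)
          (Unique.map⁺ coreVertex-injective {dump ∷ chosen} dump∷chosen-unique)
      }

    open Matching matching public using (edges; Uncovered)

    covered⇒core : ∀ {x} → x ∈ concatMap endpoints edges →
      x ≡ coreVertex dump ⊎ ∃[ v ] T v × x ≡ coreVertex (optional v)
    covered⇒core x∈ with ∈-pairUp⁻ _ (map coreVertex chosen) x∈
    ... | here eq = inj₁ eq
    ... | there x∈′ with ∈-map⁻ coreVertex x∈′
    ... | u , u∈ , refl with ∈-map⁻ optional u∈
    ... | v , v∈ , refl = inj₂ (v , proj₂ (∈-filter⁻ T? {xs = allFin s} v∈) , refl)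

    covered-optional⁺ : ∀ {v} → T v → ¬ Uncovered (coreVertex (optional v))
    covered-optional⁺ {v} Tv un = un (∈-pairUp⁺ _ (map coreVertex chosen)
      (∈-map⁺ coreVertex (∈-map⁺ optional (∈-filter⁺ T? (∈-allFin v) Tv))))

    uncovered-optional : ∀ {v} → ¬ T v → Uncovered (coreVertex (optional v))
    uncovered-optional ¬Tv x∈ with covered⇒core x∈
    ... | inj₁ eq with () ← coreVertex-injective eq
    ... | inj₂ (u , Tu , eq) with refl ← coreVertex-injective eq = ¬Tv Tu

    uncovered-permanent : ∀ {y} → Permanent y → Uncovered (from y)
    uncovered-permanent {y} perm x∈ = helper (covered⇒core x∈)
      where
      -- `dump` has index 3 and optional vertices have index at least 4, just beyond the permanent
      -- ones.
      core-big : ∀ {v} → 3 ℕ.≤ toℕ v → from y ≢ coreVertex v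
      core-big {v} 3≤v eq
        with refl ← trans (sym (strictlyInverseˡ y)) (trans (cong to eq) (to-coreVertex v))
        = ℕ.<⇒≱ perm 3≤v
      helper : from y ≡ coreVertex dump ⊎ ∃[ v ] T v × from y ≡ coreVertex (optional v) → ⊥
      helper (inj₁ eq)           = core-big (s≤s (s≤s (s≤s z≤n))) eq
      helper (inj₂ (v , _ , eq)) = core-big (s≤s (s≤s (s≤s z≤n))) eq

    labelling : Labelling (∃ Uncovered)
    labelling = record
      { label     = to ∘ proj₁
      ; injective = λ {p} {p′} → inj {p} {p′}
      ; permanent = λ y perm → (from y , uncovered-permanent perm) , strictlyInverseˡ y
      }
      where
      inj : ∀ {p p′ : ∃ Uncovered} → to (proj₁ p) ≡ to (proj₁ p′) → p ≡ p′
      inj {x , _} {y , _} eq with refl ← to-injective {x} {y} eq = refl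

  -- Isomorphic positions delete the same optional vertices.

  module _ {S T : Pred (Fin s) 0ℓ} (S? : Unary.Decidable S) (T? : Unary.Decidable T)
    (iso : position graph (Deletion.matching S?) ≅ position graph (Deletion.matching T?)) where

    private
      module S = Deletion S?
      module T = Deletion T?
      module R = Rigidity S.labelling T.labelling (proj₁ iso) (proj₂ iso)

    -- If `v` is not in `T`, its vertex survives in the second position, hence by `core-reflected`
    -- in the first, although `S` deletes it.
    iso⇒⊆ˡ : ∀ {v} → S v → T v
    iso⇒⊆ˡ {v} Sv = decidable-stable (T? v) λ ¬Tv →
      let (x , un) , eq = R.core-reflected (_ , T.uncovered-optional ¬Tv)
                            (to-coreVertex (optional v))
      in S.covered-optional⁺ Sv (subst S.Uncovered (to-injective (trans eq (sym (to-coreVertex _)))) un)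

    iso⇒⊆ʳ : ∀ {v} → T v → S v
    iso⇒⊆ʳ {v} Tv = decidable-stable (S? v) λ ¬Sv →
      let y , un = Inverse.to (proj₁ iso) (coreVertex (optional v) , S.uncovered-optional ¬Sv)
          eq = R.fixes-core (_ , S.uncovered-optional ¬Sv) (to-coreVertex (optional v))
      in T.covered-optional⁺ Tv (subst T.Uncovered (to-injective (trans eq (sym (to-coreVertex _)))) un)

  positions : NonIsomorphicPositions graph (2 ℕ.^ s)
  positions = (λ i → Deletion.matching (T? i)) , λ i j i≢j iso →
    i≢j (finToFun-injective s i j λ v →
      bits-≡ (iso⇒⊆ˡ (T? i) (T? j) iso) (iso⇒⊆ʳ (T? i) (T? j) iso))
    where
    -- The binary digits of `i` encode a subset of `Fin s`: digit 1 marks a vertex to delete.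
    T? : ∀ (i : Fin (2 ℕ.^ s)) → Unary.Decidable (λ v → finToFun {2} {s} i v ≡ suc zero)
    T? i v = finToFun {2} {s} i v Fin.≟ suc zero
    bits-≡ : ∀ {b c : Fin 2} → (b ≡ suc zero → c ≡ suc zero) → (c ≡ suc zero → b ≡ suc zero) → b ≡ c
    bits-≡ {zero}     {zero}     _ _ = refl
    bits-≡ {zero}     {suc zero} _ g = g refl
    bits-≡ {suc zero} {zero}     f _ = sym (f refl)
    bits-≡ {suc zero} {suc zero} _ _ = refl

-- Integer square root and the vanishing error term.

√ : ℕ → ℕ
√ zero    = 0
√ (suc m) with suc (√ m) ℕ.* suc (√ m) ℕ.≤? suc m
... | yes _ = suc (√ m)
... | no  _ = √ m

√-bounds : ∀ m → √ m ℕ.* √ m ℕ.≤ m × m ℕ.< suc (√ m) ℕ.* suc (√ m)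
√-bounds zero    = z≤n , s≤s z≤n
√-bounds (suc m) with suc (√ m) ℕ.* suc (√ m) ℕ.≤? suc m
... | yes p = p , ℕ.≤-<-trans (proj₂ (√-bounds m))
  (ℕ.*-mono-< (ℕ.n<1+n (suc (√ m))) (ℕ.n<1+n (suc (√ m))))
... | no ¬p = ℕ.m≤n⇒m≤1+n (proj₁ (√-bounds m)) , ℕ.≰⇒> ¬p

√-greatest : ∀ {r m} → r ℕ.* r ℕ.≤ m → r ℕ.≤ √ m
√-greatest {r} {m} r²≤m with r ℕ.≤? √ m
... | yes p = p
... | no ¬p = contradiction (ℕ.≤-trans (ℕ.*-mono-≤ (ℕ.≰⇒> ¬p) (ℕ.≰⇒> ¬p)) r²≤m)
                (ℕ.<⇒≱ (proj₂ (√-bounds m)))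

-- On a graph of the sequence, order m = i² + 4i + 12, this is at least m ∸ i².
loss : ℕ → ℕ
loss m = 4 ℕ.* √ m ℕ.+ 12

-- The threshold forces `√ m > 16 b`. As `√ m ≥ 1`, the loss is at most `16 √ m`, and
-- `16 b √ m < √ m * √ m ≤ m`.
loss-sublinear : ∀ b {m} → suc (16 ℕ.* b) ℕ.* suc (16 ℕ.* b) ℕ.≤ m → loss m ℕ.* b ℕ.< m
loss-sublinear b {m} N≤m = begin-strict
  (4 ℕ.* r ℕ.+ 12) ℕ.* b            ≤⟨ ℕ.*-monoˡ-≤ b (ℕ.+-monoʳ-≤ (4 ℕ.* r) (ℕ.*-monoʳ-≤ 12 1≤r)) ⟩
  (4 ℕ.* r ℕ.+ 12 ℕ.* r) ℕ.* b      ≡⟨ collect r b ⟩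
  (16 ℕ.* b) ℕ.* r                  <⟨ ℕ.*-monoˡ-< r {{ℕ.>-nonZero 1≤r}} R≤r ⟩
  r ℕ.* r                           ≤⟨ proj₁ (√-bounds m) ⟩
  m                                 ∎
  where
  open ℕ.≤-Reasoning
  r = √ m
  R≤r : suc (16 ℕ.* b) ℕ.≤ r
  R≤r = √-greatest N≤m
  1≤r : 1 ℕ.≤ r
  1≤r = ℕ.≤-trans (s≤s z≤n) R≤r
  collect : ∀ r b → (4 ℕ.* r ℕ.+ 12 ℕ.* r) ℕ.* b ≡ (16 ℕ.* b) ℕ.* r
  collect = solve-∀

-- Capping the loss at `m` keeps `m (1 - δ m)` a natural number. The value at 0 is a placeholder
-- that avoids division by zero.
δ : ℕ → ℚ
δ zero      = 0ℚ
δ m@(suc _) = + (loss m ⊓ m) / m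

-- `_/_` reduces fractions; passing to the unreduced fraction lets identities be checked by
-- cross-multiplication.
toℚᵘ-/ : ∀ i d-1 → toℚᵘ (i / suc d-1) ℚᵘ.≃ mkℚᵘ i d-1
toℚᵘ-/ i d-1 = ℚ.toℚᵘ-fromℚᵘ (mkℚᵘ i d-1)

-- A positive `ε` has numerator at least 1, so it is at least the reciprocal of its denominator.
/-<-pos : ∀ x m ε → 0ℚ ℚ.< ε → x ℕ.* ↧ₙ ε ℕ.< suc m → + x / suc m ℚ.< ε
/-<-pos x m (mkℚ (+ zero)    _ _) (*<* (+<+ ()))
/-<-pos x m (mkℚ ℤ.-[1+ _ ]  _ _) (*<* ())
/-<-pos x m (mkℚ (+ suc a) b _) _ x<m = ℚ.toℚᵘ-cancel-<
  (ℚᵘ.<-respˡ-≃ (ℚᵘ.≃-sym (toℚᵘ-/ (+ x) m)) (ℚᵘ.*<* (begin-strict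
    + x ℤ.* + suc b      ≡⟨ ℤ.pos-* x (suc b) ⟨
    + (x ℕ.* suc b)      <⟨ +<+ (ℕ.<-≤-trans x<m (ℕ.m≤m+n (suc m) (a ℕ.* suc m))) ⟩
    + (suc a ℕ.* suc m)  ≡⟨ ℤ.pos-* (suc a) (suc m) ⟩
    + suc a ℤ.* + suc m  ∎)))
  where open ℤ.≤-Reasoning

δ-tendsToZero : TendsToZero δ
δ-tendsToZero ε 0<ε = suc (16 ℕ.* ↧ₙ ε) ℕ.* suc (16 ℕ.* ↧ₙ ε) , small
  where
  small : ∀ m → suc (16 ℕ.* ↧ₙ ε) ℕ.* suc (16 ℕ.* ↧ₙ ε) ℕ.≤ m → ℚ.∣ δ m ∣ ℚ.< ε
  small m@(suc m-1) N≤m = subst (ℚ._< ε)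
    (sym (ℚ.0≤p⇒∣p∣≡p (ℚ.nonNegative⁻¹ (δ m) {{ℚ.normalize-nonNeg (loss m ⊓ m) m}})))
    (/-<-pos (loss m ⊓ m) m-1 ε 0<ε (ℕ.≤-<-trans
      (ℕ.*-monoˡ-≤ (↧ₙ ε) (ℕ.m⊓n≤m (loss m) m)) (loss-sublinear (↧ₙ ε) N≤m)))

0-tendsToZero : TendsToZero (λ _ → 0ℚ)
0-tendsToZero ε 0<ε = 0 , λ _ _ → 0<ε

-- Arithmetic of fractions and the power inequality.

/-+-same : ∀ x y d .{{_ : NonZero d}} → + x / d + + y / d ≡ + (x ℕ.+ y) / d
/-+-same x y d@(suc d-1) = ℚ.toℚᵘ-injective (begin
  toℚᵘ (+ x / d + + y / d)            ≈⟨ ℚ.toℚᵘ-homo-+ (+ x / d) (+ y / d) ⟩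
  toℚᵘ (+ x / d) ℚᵘ.+ toℚᵘ (+ y / d)  ≈⟨ ℚᵘ.+-cong (toℚᵘ-/ (+ x) d-1) (toℚᵘ-/ (+ y) d-1) ⟩
  mkℚᵘ (+ x) d-1 ℚᵘ.+ mkℚᵘ (+ y) d-1  ≈⟨ *≡* (trans
    (cong (ℤ._* + d) (sym (ℤ.*-distribʳ-+ (+ d) (+ x) (+ y))))
    (ℤ.*-assoc (+ (x ℕ.+ y)) (+ d) (+ d))) ⟩
  mkℚᵘ (+ (x ℕ.+ y)) d-1              ≈⟨ toℚᵘ-/ (+ (x ℕ.+ y)) d-1 ⟨
  toℚᵘ (+ (x ℕ.+ y) / d)              ∎)
  where open ℚᵘ.≃-Reasoning

/1-*-/ : ∀ x d .{{_ : NonZero d}} → + d / 1 * (+ x / d) ≡ + x / 1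
/1-*-/ x d@(suc d-1) = ℚ.toℚᵘ-injective (begin
  toℚᵘ (+ d / 1 * (+ x / d))          ≈⟨ ℚ.toℚᵘ-homo-* (+ d / 1) (+ x / d) ⟩
  toℚᵘ (+ d / 1) ℚᵘ.* toℚᵘ (+ x / d)  ≈⟨ ℚᵘ.*-cong (toℚᵘ-/ (+ d) 0) (toℚᵘ-/ (+ x) d-1) ⟩
  mkℚᵘ (+ d) 0 ℚᵘ.* mkℚᵘ (+ x) d-1    ≈⟨ *≡* (trans (ℤ.*-identityʳ _) (trans (ℤ.*-comm (+ d) (+ x))
    (cong (λ z → + x ℤ.* + z) (sym (ℕ.+-identityʳ d))))) ⟩
  mkℚᵘ (+ x) 0                        ≈⟨ toℚᵘ-/ (+ x) 0 ⟨
  toℚᵘ (+ x / 1)                      ∎)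
  where open ℚᵘ.≃-Reasoning

/1-*-/1 : ∀ x y → + x / 1 * (+ y / 1) ≡ + (x ℕ.* y) / 1
/1-*-/1 x y = ℚ.toℚᵘ-injective (begin
  toℚᵘ (+ x / 1 * (+ y / 1))          ≈⟨ ℚ.toℚᵘ-homo-* (+ x / 1) (+ y / 1) ⟩
  toℚᵘ (+ x / 1) ℚᵘ.* toℚᵘ (+ y / 1)  ≈⟨ ℚᵘ.*-cong (toℚᵘ-/ (+ x) 0) (toℚᵘ-/ (+ y) 0) ⟩
  mkℚᵘ (+ x) 0 ℚᵘ.* mkℚᵘ (+ y) 0      ≈⟨ *≡* (cong (ℤ._* + 1) (sym (ℤ.pos-* x y))) ⟩
  mkℚᵘ (+ (x ℕ.* y)) 0                ≈⟨ toℚᵘ-/ (+ (x ℕ.* y)) 0 ⟨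
  toℚᵘ (+ (x ℕ.* y) / 1)              ∎)
  where open ℚᵘ.≃-Reasoning

n/n≡1ℚ : ∀ n .{{_ : NonZero n}} → + n / n ≡ 1ℚ
n/n≡1ℚ n@(suc n-1) = ℚ.toℚᵘ-injective
  (ℚᵘ.≃-trans (toℚᵘ-/ (+ n) n-1) (*≡* (ℤ.*-comm (+ n) (+ 1))))

2^-/1 : ∀ p → (+ 2 / 1) ^ p ≡ + (2 ℕ.^ p) / 1
2^-/1 zero    = refl
2^-/1 (suc p) = trans (cong (λ z → + 2 / 1 * z) (2^-/1 p)) (/1-*-/1 2 (2 ℕ.^ p))

1-δ : ∀ m .{{_ : NonZero m}} → 1ℚ - δ m ≡ + (m ∸ (loss m ⊓ m)) / m
1-δ m@(suc _) = begin
  1ℚ - δ m                ≡⟨ cong (_- δ m) (n/n≡1ℚ m) ⟨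
  -- Truncated subtraction is exact here because the loss is capped at `m`.
  + m / m - δ m           ≡⟨ cong (λ z → + z / m - δ m) (ℕ.m∸n+n≡m (ℕ.m⊓n≤n (loss m) m)) ⟨
  + (y ℕ.+ x) / m - δ m   ≡⟨ cong (_- δ m) (/-+-same y x m) ⟨
  + y / m + δ m - δ m     ≡⟨ ℚ.+-assoc (+ y / m) (δ m) (- δ m) ⟩
  + y / m + (δ m - δ m)   ≡⟨ cong (λ z → + y / m + z) (ℚ.+-inverseʳ (δ m)) ⟩
  + y / m + 0ℚ            ≡⟨ ℚ.+-identityʳ (+ y / m) ⟩
  + y / m                 ∎
  where
  open ≡-Reasoning
  x = loss m ⊓ m
  y = m ∸ x

-- The base equals 2 and the exponent is the natural number `p`, written with denominator 1; the
-- hypothesis gives `p ≤ s`.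
realPower : ∀ m s .{{_ : NonZero m}} → m ℕ.≤ loss m ℕ.+ s →
  RealPower≤ (+ m / m + 1ℚ - 0ℚ) (+ m / 1 * (1ℚ - δ m)) (2 ℕ.^ s)
realPower m s m≤loss+s =
  subst (0ℚ ℚ.≤_) (sym base) (ℚ.nonNegative⁻¹ (+ 2 / 1)) ,
  m ∸ (loss m ⊓ m) , 0 ,
  trans (cong (λ z → + m / 1 * z) (1-δ m)) (/1-*-/ p m) ,
  subst (λ b → b ^ p ℚ.≤ + ((2 ℕ.^ s) ℕ.^ 1) / 1) (sym base)
    (subst (ℚ._≤ _) (sym (2^-/1 p)) (/1-mono (ℕ.≤-trans (ℕ.^-monoʳ-≤ 2 p≤s)
      (ℕ.≤-reflexive (sym (ℕ.^-identityʳ (2 ℕ.^ s)))))))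
  where
  p = m ∸ (loss m ⊓ m)
  base : + m / m + 1ℚ - 0ℚ ≡ + 2 / 1
  base = cong (λ z → z + 1ℚ - 0ℚ) (n/n≡1ℚ m)
  p≤s : p ℕ.≤ s
  p≤s = ℕ.m≤n+o⇒m∸n≤o m (loss m ⊓ m) (begin
    m                          ≤⟨ ℕ.⊓-glb m≤loss+s (ℕ.m≤m+n m s) ⟩
    (loss m ℕ.+ s) ⊓ (m ℕ.+ s) ≡⟨ ℕ.+-distribʳ-⊓ s (loss m) m ⟨
    (loss m ⊓ m) ℕ.+ s         ∎)
    where open ℕ.≤-Reasoning
  /1-mono : ∀ {x y} → x ℕ.≤ y → + x / 1 ℚ.≤ + y / 1
  /1-mono {x} {y} x≤y = ℚ.toℚᵘ-cancel-≤
    (ℚᵘ.≤-respˡ-≃ (ℚᵘ.≃-sym (toℚᵘ-/ (+ x) 0)) (ℚᵘ.≤-respʳ-≃ (ℚᵘ.≃-sym (toℚᵘ-/ (+ y) 0))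
      (ℚᵘ.*≤* (ℤ.*-monoʳ-≤-nonNeg (+ 1) (ℤ.+≤+ x≤y)))))

-- An injective code from a square grid.

↑ˡ≢↑ʳ : ∀ m n (i : Fin m) (j : Fin n) → i ↑ˡ n ≢ m ↑ʳ j
↑ˡ≢↑ʳ m n i j eq
  with () ← trans (sym (Fin.splitAt-↑ˡ m i n)) (trans (cong (splitAt m) eq) (Fin.splitAt-↑ʳ m n j))

module Grid (r : ℕ) where

  row column : Fin (r ℕ.* r) → Fin (r ℕ.+ r)
  row    v = quotient {r} r v ↑ˡ r
  column v = r ↑ʳ remainder {r} r v

  row×column-injective : ∀ u v → row u ≡ row v → column u ≡ column v → u ≡ v
  row×column-injective u v row≡ column≡ = begin
    u
      ≡⟨ Fin.combine-remQuot {r} r u ⟨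
    combine (quotient {r} r u) (remainder {r} r u)
      ≡⟨ cong₂ combine (Fin.↑ˡ-injective r _ _ row≡) (Fin.↑ʳ-injective r _ _ column≡) ⟩
    combine (quotient {r} r v) (remainder {r} r v)
      ≡⟨ Fin.combine-remQuot {r} r v ⟩
    v ∎
    where open ≡-Reasoning

  -- A grid cell is joined to all ports except its row and its column, so `2 r` ports serve `r * r`
  -- cells. The extra `zero` takes the full set, which no cell has.
  Code : REL (Fin (suc (r ℕ.* r))) (Fin (r ℕ.+ r)) 0ℓ
  Code zero    i = ⊤
  Code (suc v) i = i ≢ row v × i ≢ column v

  code? : Decidable Code
  code? zero    i = yes tt
  code? (suc v) i = ¬? (i Fin.≟ row v) ×-dec ¬? (i Fin.≟ column v)

  code-injective : ∀ u v → (∀ i → Code u i ⇔ Code v i) → u ≡ v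
  code-injective zero    zero    _    = refl
  code-injective zero    (suc v) same = contradiction refl (proj₁ (Equivalence.to (same (row v)) tt))
  code-injective (suc u) zero    same = contradiction refl (proj₁ (Equivalence.from (same (row u)) tt))
  code-injective (suc u) (suc v) same = cong suc (row×column-injective u v
    -- If the rows differ, `row u` lies in the code of `v`, as it is not a column either, but not in
    -- the code of `u`.
    (decidable-stable (row u Fin.≟ row v) λ row≢ →
      proj₁ (Equivalence.from (same (row u)) (row≢ , ↑ˡ≢↑ʳ r r _ _)) refl)
    (decidable-stable (column u Fin.≟ column v) λ column≢ →
      proj₂ (Equivalence.from (same (column u)) ((λ eq → ↑ˡ≢↑ʳ r r _ _ (sym eq)) , column≢)) refl))

-- The sequence of graphs and its parameters.

module Sequence (i : ℕ) where

  -- Side `2 + i` yields `i² + 4 i + 5` codes, enough for the `i² + 4` core vertices.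
  open Grid (2 ℕ.+ i)

  square-bound : 4 ℕ.+ i ℕ.* i ℕ.≤ suc ((2 ℕ.+ i) ℕ.* (2 ℕ.+ i))
  square-bound = subst (4 ℕ.+ i ℕ.* i ℕ.≤_) (expand i) (ℕ.m≤m+n _ _)
    where
    expand : ∀ i → 4 ℕ.+ i ℕ.* i ℕ.+ (1 ℕ.+ 4 ℕ.* i) ≡ suc ((2 ℕ.+ i) ℕ.* (2 ℕ.+ i))
    expand = solve-∀

  embed : Fin (4 ℕ.+ i ℕ.* i) → Fin (suc ((2 ℕ.+ i) ℕ.* (2 ℕ.+ i)))
  embed v = inject≤ v square-bound

  open Coded (λ v → Code (embed v)) (λ v → code? (embed v)) (λ _ → tt)
    (λ u v same → Fin.inject≤-injective square-bound square-bound u v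
      (code-injective (embed u) (embed v) same))
    public using (order; graph; neighbourhoodDiversity; positions)

  i²≤order : i ℕ.* i ℕ.≤ order
  i²≤order = ℕ.≤-trans (ℕ.m≤n+m (i ℕ.* i) 4) (ℕ.m≤m+n _ _)

  i≤order : i ℕ.≤ order
  i≤order = ℕ.≤-trans (i≤i² i) i²≤order
    where
    i≤i² : ∀ i → i ℕ.≤ i ℕ.* i
    i≤i² zero      = z≤n
    i≤i² i@(suc _) = ℕ.m≤m*n i i

  -- From `i * i ≤ order` follows `i ≤ √ order`, so the loss covers the `4 i + 12` vertices beyond
  -- the `i²` optional ones.
  order≤loss+i² : order ℕ.≤ loss order ℕ.+ i ℕ.* i
  order≤loss+i² = begin
    order                        ≡⟨ expand i ⟩
    4 ℕ.* i ℕ.+ 12 ℕ.+ i ℕ.* i   ≤⟨ ℕ.+-monoˡ-≤ (i ℕ.* i) (ℕ.+-monoˡ-≤ 12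
                                     (ℕ.*-monoʳ-≤ 4 (√-greatest {i} i²≤order))) ⟩
    loss order ℕ.+ i ℕ.* i       ∎
    where
    open ℕ.≤-Reasoning
    expand : ∀ i → 4 ℕ.+ i ℕ.* i ℕ.+ (2 ℕ.+ i ℕ.+ (2 ℕ.+ i) ℕ.+ (2 ℕ.+ i ℕ.+ (2 ℕ.+ i))) ≡
                   4 ℕ.* i ℕ.+ 12 ℕ.+ i ℕ.* i
    expand = solve-∀

theorem7 : Σ[ n ∈ (ℕ → ℕ) ]
    Σ[ G ∈ ((i : ℕ) → SimpleGraph (Fin (n i))) ]
    Σ[ ν ∈ (ℕ → ℕ) ]
    Σ[ δ₁ ∈ (ℕ → ℚ) ]
    Σ[ δ₂ ∈ (ℕ → ℚ) ]
    ( (∀ i → IsNeighbourhoodDiversity (G i) (ν i))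
    × TendsToInfinity ν
    × TendsToZero δ₁
    × TendsToZero δ₂
    × (∀ i → .{{_ : NonZero (ν i)}} →
    ∃[ k ] (NonIsomorphicPositions (G i) k
    × RealPower≤ ((+ n i) / ν i + 1ℚ - δ₁ (ν i))
    ((+ ν i) / 1 * (1ℚ - δ₂ (ν i)))
    k)))
-- As `n / ν` is 1, the base is exactly 2 and the first error term is 0; the exponent bears all the
-- loss.
theorem7 = order , graph , order , (λ _ → 0ℚ) , δ ,
  neighbourhoodDiversity ,
  (λ B → B , λ i B≤i → ℕ.≤-trans B≤i (i≤order i)) ,
  0-tendsToZero ,
  δ-tendsToZero ,
  λ i → 2 ℕ.^ (i ℕ.* i) , positions i , realPower (order i) (i ℕ.* i) (order≤loss+i² i)
  where open Sequence
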